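{- For every integer $k\ge 1$ there exists a graph $G$ with $\operatorname{tw}(G)\le k$ and $\operatorname{box}(G)\ge k\left(1-\frac{2}{\sqrt{k}}\right)$.
   Context: The boxicity $\operatorname{box}(G)$ is the minimum $b$ such that $G$ is the intersection graph of axis-parallel boxes in $\mathbb{R}^b$ (products of $b$ closed intervals), one box per vertex. The treewidth $\operatorname{tw}(G)$ is the minimum, over all tree decompositions $(\{X_i\},T)$ of $G$ (a tree $T$ with vertex subsets $X_i$ at its nodes covering all vertices and all edges, such that for each vertex the nodes containing it form a connected subtree), of $\max_i|X_i|-1$. -}

module Defs where

open import Level using (0ℓ)
open import Data.Empty using (⊥; ⊥-elim)
open import Data.Fin.Base using (Fin; zero; suc; inject₁; fromℕ)
open import Data.Fin.Subset using (Subset; ∣_∣; _∈_)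
import Data.Integer.Base as ℤ
import Data.Integer.Properties as ℤ
open import Data.Nat.Base as ℕ using (ℕ; NonZero)
import Data.Nat.Coprimality as Coprime
import Data.Nat.Induction as ℕ
import Data.Nat.Properties as ℕ
open import Data.Product.Base using (Σ; ∃; _×_; _,_; proj₁; proj₂)
open import Data.Rational.Base as ℚ using (ℚ; 0ℚ; 1ℚ; _<_; _≤_; _+_; _*_; 1/_)
import Data.Rational.Properties as ℚ
open import Data.Sum.Base using (_⊎_; inj₁; inj₂; swap)
open import Data.Unit.Base using (⊤)
import Data.Vec.Functional as Vector
open import Function.Base using (_∘_)
open import Function.Bundles using (_⇔_; mk⇔)
open import Function.Definitions using (Injective)
open import Relation.Binary.Construct.Closure.ReflexiveTransitive using (Star)
open import Relation.Binary.Core using (Rel)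
open import Relation.Binary.Definitions using (Decidable; Symmetric; tri<; tri≈; tri>)
open import Relation.Binary.PropositionalEquality
open import Relation.Nullary.Decidable.Core using (yes; no)
open import Relation.Nullary.Negation.Core using (¬_)
open import Relation.Unary using (Pred)

------------------------------------------------------------------------
-- Real numbers as two-sided, located Dedekind cuts of ℚ.
-- L q means q < x, and U q means x < q.

record ℝ : Set₁ where
  field
    L U      : ℚ → Set
    L-inh    : ∃ L
    U-inh    : ∃ U
    L-down   : ∀ {p q} → p < q → L q → L p
    U-up     : ∀ {p q} → p < q → U p → U q
    L-round  : ∀ {q} → L q → ∃ λ r → q < r × L r
    U-round  : ∀ {q} → U q → ∃ λ r → r < q × U r
    disjoint : ∀ {q} → L q → U q → ⊥
    located  : ∀ {p q} → p < q → L p ⊎ U q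

  L<U : ∀ {p q} → L p → U q → p < q
  L<U {p} {q} Lp Uq with ℚ.<-cmp p q
  ... | tri< p<q _ _  = p<q
  ... | tri≈ _ refl _ = ⊥-elim (disjoint Lp Uq)
  ... | tri> _ _ q<p  = ⊥-elim (disjoint Lp (U-up q<p Uq))

open ℝ

infix 4 _≤ℝ_

_≤ℝ_ : ℝ → ℝ → Set
x ≤ℝ y = ∀ q → L x q → L y q

record Positive (x : ℝ) : Set where
  constructor pos
  field 0<x : L x 0ℚ

private
  <-of : ∀ {p q p′ q′} → p ≡ p′ → q ≡ q′ → p < q → p′ < q′
  <-of refl refl p<q = p<q

  0<1 : 0ℚ < 1ℚ
  0<1 = ℚ.positive⁻¹ 1ℚ

  q<q+1 : ∀ q → q < q + 1ℚ
  q<q+1 q = <-of (ℚ.+-identityʳ q) refl (ℚ.+-monoʳ-< q 0<1)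

  q-1<q : ∀ q → q ℚ.- 1ℚ < q
  q-1<q q = <-of refl (ℚ.+-identityʳ q) (ℚ.+-monoʳ-< q (ℚ.neg-antimono-< 0<1))

ℕ→ℚ : ℕ → ℚ
ℕ→ℚ n = ℤ.+ n ℚ./ 1

ℕ→ℚ-positive : ∀ n .{{_ : NonZero n}} → 0ℚ < ℕ→ℚ n
ℕ→ℚ-positive n = ℚ.positive⁻¹ (ℕ→ℚ n) {{ℚ.normalize-pos n 1}}

ℕ→ℚ-mono-≤ : ∀ {m n} → m ℕ.≤ n → ℕ→ℚ m ≤ ℕ→ℚ n
ℕ→ℚ-mono-≤ {m} {n} m≤n
  rewrite ℚ.normalize-coprime {m} {0} (Coprime.sym (Coprime.1-coprimeTo m))
        | ℚ.normalize-coprime {n} {0} (Coprime.sym (Coprime.1-coprimeTo n))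
  = ℚ.*≤* (ℤ.*-monoʳ-≤-nonNeg (ℤ.+ 1) (ℤ.+≤+ m≤n))

ℚ→ℝ : ℚ → ℝ
ℚ→ℝ c = record
  { L        = _< c
  ; U        = c <_
  ; L-inh    = c ℚ.- 1ℚ , q-1<q c
  ; U-inh    = c + 1ℚ , q<q+1 c
  ; L-down   = ℚ.<-trans
  ; U-up     = λ p<q c<p → ℚ.<-trans c<p p<q
  ; L-round  = ℚ.<-dense
  ; U-round  = λ c<q → let r , c<r , r<q = ℚ.<-dense c<q in r , r<q , c<r
  ; disjoint = ℚ.<-asym
  ; located  = loc
  }
  where
  loc : ∀ {p q} → p < q → p < c ⊎ c < q
  loc {p} p<q with p ℚ.<? c
  ... | yes p<c = inj₁ p<c
  ... | no  p≮c = inj₂ (ℚ.≤-<-trans (ℚ.≮⇒≥ p≮c) p<q)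

ℕ→ℝ : ℕ → ℝ
ℕ→ℝ n = ℚ→ℝ (ℕ→ℚ n)

-- √k = sup { r ∈ ℚ ∣ r² ≤ k } = inf { r ∈ ℚ ∣ 0 ≤ r, k ≤ r² }.

infix 9 √_

√_ : ℕ → ℝ
√ k = record
  { L        = λ q → ∃ λ r → q < r × r * r ≤ c
  ; U        = λ q → ∃ λ r → 0ℚ ≤ r × r < q × c ≤ r * r
  ; L-inh    = 0ℚ ℚ.- 1ℚ , 0ℚ , q-1<q 0ℚ , 0≤c
  ; U-inh    = c + 1ℚ + 1ℚ , c + 1ℚ , 0≤c+1 , q<q+1 _ , c≤[c+1]²
  ; L-down   = λ p<q (r , q<r , r²≤c) → r , ℚ.<-trans p<q q<r , r²≤c
  ; U-up     = λ p<q (r , 0≤r , r<p , c≤r²) → r , 0≤r , ℚ.<-trans r<p p<q , c≤r²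
  ; L-round  = λ (r , q<r , r²≤c) →
                 let m , q<m , m<r = ℚ.<-dense q<r in m , q<m , r , m<r , r²≤c
  ; U-round  = λ (r , 0≤r , r<q , c≤r²) →
                 let m , r<m , m<q = ℚ.<-dense r<q in m , m<q , r , 0≤r , r<m , c≤r²
  ; disjoint = λ (r , q<r , r²≤c) (s , 0≤s , s<q , c≤s²) →
                 disj 0≤s (ℚ.<-trans s<q q<r) (ℚ.≤-trans r²≤c c≤s²)
  ; located  = loc
  }
  where
  c : ℚ
  c = ℕ→ℚ k

  0≤c : 0ℚ ≤ c
  0≤c = ℕ→ℚ-mono-≤ {0} {k} ℕ.z≤n

  1≤c+1 : 1ℚ ≤ c + 1ℚ
  1≤c+1 = subst (_≤ c + 1ℚ) (ℚ.+-identityˡ 1ℚ) (ℚ.+-monoˡ-≤ 1ℚ 0≤c)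

  0≤c+1 : 0ℚ ≤ c + 1ℚ
  0≤c+1 = ℚ.≤-trans (ℚ.<⇒≤ 0<1) 1≤c+1

  c≤[c+1]² : c ≤ (c + 1ℚ) * (c + 1ℚ)
  c≤[c+1]² = ℚ.≤-trans (ℚ.<⇒≤ (q<q+1 c))
    (subst (_≤ (c + 1ℚ) * (c + 1ℚ)) (ℚ.*-identityʳ (c + 1ℚ))
      (ℚ.*-monoˡ-≤-nonNeg (c + 1ℚ) {{ℚ.nonNegative 0≤c+1}} 1≤c+1))

  disj : ∀ {s r} → 0ℚ ≤ s → s < r → r * r ≤ s * s → ⊥
  disj {s} {r} 0≤s s<r r²≤s² = ℚ.<-irrefl refl
    (ℚ.<-≤-trans
      (ℚ.≤-<-trans
        (ℚ.*-monoˡ-≤-nonNeg s {{ℚ.nonNegative 0≤s}} (ℚ.<⇒≤ s<r))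
        (ℚ.*-monoˡ-<-pos r {{ℚ.positive (ℚ.≤-<-trans 0≤s s<r)}} s<r))
      r²≤s²)

  loc : ∀ {p q} → p < q →
        (∃ λ r → p < r × r * r ≤ c) ⊎ (∃ λ r → 0ℚ ≤ r × r < q × c ≤ r * r)
  loc p<q with ℚ.<-dense p<q
  ... | m , p<m , m<q with m ℚ.≤? 0ℚ
  ...   | yes m≤0 = inj₁ (0ℚ , ℚ.<-≤-trans p<m m≤0 , 0≤c)
  ...   | no  m≰0 with m * m ℚ.≤? c
  ...     | yes m²≤c = inj₁ (m , p<m , m²≤c)
  ...     | no  m²≰c = inj₂ (m , ℚ.<⇒≤ (ℚ.≰⇒> m≰0) , m<q , ℚ.<⇒≤ (ℚ.≰⇒> m²≰c))

instance
  √-positive : ∀ {k} .{{_ : NonZero k}} → Positive (√ k)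
  √-positive {k} =
    pos (1ℚ , 0<1 , ℕ→ℚ-mono-≤ {1} {k} (ℕ.>-nonZero⁻¹ k))

infixl 7 _·ℝ_ _/ℝ_
infixl 6 _-ℝ_

-- n ·ℝ x is the product n x:  q < n x  iff  q / n < x.

_·ℝ_ : (n : ℕ) .{{_ : NonZero n}} → ℝ → ℝ
n ·ℝ x = record
  { L        = L x ∘ f
  ; U        = U x ∘ f
  ; L-inh    = let s , Ls = L-inh x in g s , subst (L x) (sym (f∘g s)) Ls
  ; U-inh    = let s , Us = U-inh x in g s , subst (U x) (sym (f∘g s)) Us
  ; L-down   = L-down x ∘ f-mono
  ; U-up     = U-up x ∘ f-mono
  ; L-round  = λ {q} Lq → let s , fq<s , Ls = L-round x Lq in
                 g s , <-of (g∘f q) refl (g-mono fq<s) , subst (L x) (sym (f∘g s)) Ls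
  ; U-round  = λ {q} Uq → let s , s<fq , Us = U-round x Uq in
                 g s , <-of refl (g∘f q) (g-mono s<fq) , subst (U x) (sym (f∘g s)) Us
  ; disjoint = disjoint x
  ; located  = located x ∘ f-mono
  }
  where
  c : ℚ
  c = ℕ→ℚ n

  instance
    c-pos : ℚ.Positive c
    c-pos = ℚ.positive (ℕ→ℚ-positive n)

    c-nonZero : ℚ.NonZero c
    c-nonZero = ℚ.pos⇒nonZero c

  f g : ℚ → ℚ
  f q = q * 1/ c
  g s = s * c

  f-mono : ∀ {p q} → p < q → f p < f q
  f-mono = ℚ.*-monoˡ-<-pos (1/ c) {{ℚ.1/pos⇒pos c}}

  g-mono : ∀ {p q} → p < q → g p < g q
  g-mono = ℚ.*-monoˡ-<-pos c

  f∘g : ∀ s → f (g s) ≡ s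
  f∘g s = trans (ℚ.*-assoc s c (1/ c))
                (trans (cong (s *_) (ℚ.*-inverseʳ c)) (ℚ.*-identityʳ s))

  g∘f : ∀ q → g (f q) ≡ q
  g∘f q = trans (ℚ.*-assoc q (1/ c) c)
                (trans (cong (q *_) (ℚ.*-inverseˡ c)) (ℚ.*-identityʳ q))

-- n -ℝ x is the difference n - x:  q < n - x  iff  x < n - q.

_-ℝ_ : ℕ → ℝ → ℝ
n -ℝ x = record
  { L        = U x ∘ f
  ; U        = L x ∘ f
  ; L-inh    = let s , Us = U-inh x in f s , subst (U x) (sym (f∘f s)) Us
  ; U-inh    = let s , Ls = L-inh x in f s , subst (L x) (sym (f∘f s)) Ls
  ; L-down   = U-up x ∘ f-anti
  ; U-up     = L-down x ∘ f-anti
  ; L-round  = λ {q} Uq → let s , s<fq , Us = U-round x Uq in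
                 f s , <-of (f∘f q) refl (f-anti s<fq) , subst (U x) (sym (f∘f s)) Us
  ; U-round  = λ {q} Lq → let s , fq<s , Ls = L-round x Lq in
                 f s , <-of refl (f∘f q) (f-anti fq<s) , subst (L x) (sym (f∘f s)) Ls
  ; disjoint = λ Uq Lq → disjoint x Lq Uq
  ; located  = λ p<q → swap (located x (f-anti p<q))
  }
  where
  c : ℚ
  c = ℕ→ℚ n

  f : ℚ → ℚ
  f q = c ℚ.- q

  f-anti : ∀ {p q} → p < q → f q < f p
  f-anti p<q = ℚ.+-monoʳ-< c (ℚ.neg-antimono-< p<q)

  f∘f : ∀ q → f (f q) ≡ q
  f∘f q = begin
    c + ℚ.- (c + ℚ.- q)          ≡⟨ cong (c +_) (ℚ.neg-distrib-+ c (ℚ.- q)) ⟩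
    c + (ℚ.- c + ℚ.- (ℚ.- q))    ≡⟨ cong (λ z → c + (ℚ.- c + z)) (⁻¹-involutive q) ⟩
    c + (ℚ.- c + q)              ≡⟨ ℚ.+-assoc c (ℚ.- c) q ⟨
    (c + ℚ.- c) + q              ≡⟨ cong (_+ q) (ℚ.+-inverseʳ c) ⟩
    0ℚ + q                       ≡⟨ ℚ.+-identityˡ q ⟩
    q                            ∎
    where
    open ≡-Reasoning
    open import Algebra.Properties.Group ℚ.+-0-group using (⁻¹-involutive)

-- n /ℝ x is the quotient n / x for x > 0:
-- q < n / x  iff  q s < n for some s > x,
-- n / x < q  iff  n < q s for some 0 < s < x.

_/ℝ_ : (n : ℕ) .{{_ : NonZero n}} (x : ℝ) {{_ : Positive x}} → ℝ
_/ℝ_ n x {{pos 0<x}} = record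
  { L        = Lo
  ; U        = Up
  ; L-inh    = 0ℚ , lo≤0 ℚ.≤-refl
  ; U-inh    = let s , 0<s , Ls = L-round x 0<x
                   r , rs≡c+1   = quot (c + 1ℚ) 0<s
               in r , s , 0<s , Ls , <-of refl (sym rs≡c+1) (q<q+1 c)
  ; L-down   = λ p<q (s , Us , qs<c) →
                 s , Us , ℚ.<-trans (mulʳ (L<U x 0<x Us) p<q) qs<c
  ; U-up     = λ p<q (s , 0<s , Ls , c<ps) →
                 s , 0<s , Ls , ℚ.<-trans c<ps (mulʳ 0<s p<q)
  ; L-round  = λ (s , Us , qs<c) →
                 let m , qs<m , m<c = ℚ.<-dense qs<c
                     0<s            = L<U x 0<x Us
                     r , rs≡m       = quot m 0<s
                 in r , cancelʳ 0<s (<-of refl (sym rs≡m) qs<m)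
                  , s , Us , <-of (sym rs≡m) refl m<c
  ; U-round  = λ (s , 0<s , Ls , c<qs) →
                 let m , c<m , m<qs = ℚ.<-dense c<qs
                     r , rs≡m       = quot m 0<s
                 in r , cancelʳ 0<s (<-of (sym rs≡m) refl m<qs)
                  , s , 0<s , Ls , <-of refl (sym rs≡m) c<m
  ; disjoint = λ {q} (s , Us , qs<c) (t , 0<t , Lt , c<qt) →
                 let 0<q = cancelʳ {t} {0ℚ} {q} 0<t (<-of (sym (ℚ.*-zeroˡ t)) refl (ℚ.<-trans 0<c c<qt))
                 in ℚ.<-asym (ℚ.<-trans qs<c c<qt)
                      (ℚ.*-monoʳ-<-pos q {{ℚ.positive 0<q}} (L<U x Lt Us))
  ; located  = loc
  }
  where
  c : ℚ
  c = ℕ→ℚ n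

  0<c : 0ℚ < c
  0<c = ℕ→ℚ-positive n

  Lo Up : ℚ → Set
  Lo q = ∃ λ s → U x s × q * s < c
  Up q = ∃ λ s → 0ℚ < s × L x s × c < q * s

  mulʳ : ∀ {s p q} → 0ℚ < s → p < q → p * s < q * s
  mulʳ {s} 0<s = ℚ.*-monoˡ-<-pos s {{ℚ.positive 0<s}}

  cancelʳ : ∀ {s p q} → 0ℚ < s → p * s < q * s → p < q
  cancelʳ {s} 0<s = ℚ.*-cancelʳ-<-nonNeg s {{ℚ.nonNegative (ℚ.<⇒≤ 0<s)}}

  quot : ∀ m {s} → 0ℚ < s → ∃ λ r → r * s ≡ m
  quot m {s} 0<s = m * 1/ s ,
    trans (ℚ.*-assoc m (1/ s) s)
          (trans (cong (m *_) (ℚ.*-inverseˡ s)) (ℚ.*-identityʳ m))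
    where
    instance
      s-nonZero : ℚ.NonZero s
      s-nonZero = ℚ.pos⇒nonZero s {{ℚ.positive 0<s}}

  lo≤0 : ∀ {p} → p ≤ 0ℚ → Lo p
  lo≤0 {p} p≤0 = let s , Us = U-inh x
                     0≤s    = ℚ.<⇒≤ (L<U x 0<x Us)
    in s , Us , ℚ.≤-<-trans
         (subst (p * s ≤_) (ℚ.*-zeroˡ s)
           (ℚ.*-monoʳ-≤-nonNeg s {{ℚ.nonNegative 0≤s}} p≤0)) 0<c

  loc : ∀ {p q} → p < q → Lo p ⊎ Up q
  loc {p} {q} p<q with p ℚ.≤? 0ℚ
  ... | yes p≤0 = inj₁ (lo≤0 p≤0)
  ... | no  p≰0 = go (located x a<b)
    where
    0<p : 0ℚ < p
    0<p = ℚ.≰⇒> p≰0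

    0<q : 0ℚ < q
    0<q = ℚ.<-trans 0<p p<q

    a b : ℚ
    a = proj₁ (quot c 0<q)
    b = proj₁ (quot c 0<p)

    aq≡c : a * q ≡ c
    aq≡c = proj₂ (quot c 0<q)

    bp≡c : b * p ≡ c
    bp≡c = proj₂ (quot c 0<p)

    0<a : 0ℚ < a
    0<a = cancelʳ 0<q (<-of (sym (ℚ.*-zeroˡ q)) (sym aq≡c) 0<c)

    a<b : a < b
    a<b = cancelʳ 0<p
      (<-of refl (trans aq≡c (sym bp≡c)) (ℚ.*-monoʳ-<-pos a {{ℚ.positive 0<a}} p<q))

    go : L x a ⊎ U x b → Lo p ⊎ Up q
    go (inj₁ La) = let s , a<s , Ls = L-round x La in
      inj₂ (s , ℚ.<-trans 0<a a<s , Ls , <-of aq≡c (ℚ.*-comm s q) (mulʳ 0<q a<s))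
    go (inj₂ Ub) = let s , s<b , Us = U-round x Ub in
      inj₁ (s , Us , <-of (ℚ.*-comm s p) bp≡c (mulʳ 0<p s<b))

------------------------------------------------------------------------

record Graph : Set₁ where
  infix 4 _~_ _~?_
  field
    order  : ℕ
    _~_    : Rel (Fin order) 0ℓ
    _~?_   : Decidable _~_
    ~-sym  : Symmetric _~_
    ~-irr  : ∀ {v} → ¬ (v ~ v)

  Vertex : Set
  Vertex = Fin order

  ConnectedOn : Pred Vertex 0ℓ → Set
  ConnectedOn S = ∀ {u v} → S u → S v → Star (λ a b → S a × S b × a ~ b) u v

  record Cycle : Set where
    field
      {extra}  : ℕ
      at       : Fin (3 ℕ.+ extra) → Vertex
      distinct : Injective _≡_ _≡_ at
      step     : ∀ i → at (inject₁ i) ~ at (suc i)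
      close    : at (fromℕ (2 ℕ.+ extra)) ~ at zero

  record IsTree : Set where
    field
      nonEmpty  : NonZero order
      connected : ConnectedOn (λ _ → ⊤)
      acyclic   : ¬ Cycle

------------------------------------------------------------------------

record TreeDecomposition (G : Graph) : Set₁ where
  open Graph G
  field
    T          : Graph
    isTree     : Graph.IsTree T
    bag        : Graph.Vertex T → Subset order
    coverV     : ∀ v → ∃ λ i → v ∈ bag i
    coverE     : ∀ {u v} → u ~ v → ∃ λ i → u ∈ bag i × v ∈ bag i
    coherent   : ∀ v → Graph.ConnectedOn T (λ i → v ∈ bag i)

  -- Truncated subtraction matters only when G has no vertices.
  width : ℕ
  width = Vector.foldr ℕ._⊔_ 0 (λ i → ∣ bag i ∣) ℕ.∸ 1

------------------------------------------------------------------------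

record Interval : Set₁ where
  field
    lo hi : ℝ
    lo≤hi : lo ≤ℝ hi

_∈ᴵ_ : ℝ → Interval → Set
x ∈ᴵ I = Interval.lo I ≤ℝ x × x ≤ℝ Interval.hi I

Box : ℕ → Set₁
Box b = Fin b → Interval

_∈ᴮ_ : ∀ {b} → (Fin b → ℝ) → Box b → Set
p ∈ᴮ B = ∀ i → p i ∈ᴵ B i

Meets : ∀ {b} → Box b → Box b → Set₁
Meets B C = ∃ λ p → p ∈ᴮ B × p ∈ᴮ C

record BoxRepresentation (G : Graph) (b : ℕ) : Set₁ where
  open Graph G
  field
    box  : Vertex → Box b
    spec : ∀ {u v} → u ≢ v → (u ~ v ⇔ Meets (box u) (box v))

------------------------------------------------------------------------

IsMinimum : ∀ {ℓ} → Pred ℕ ℓ → Pred ℕ ℓ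
IsMinimum P m = P m × (∀ {n} → P n → m ℕ.≤ n)

-- Classically every inhabited set of naturals has a minimum; constructively
-- only its double negation holds.  Hence the comparisons "min P ≤ k" and
-- "min P ≥ x" are unfolded below, and shown to agree with the minimum.

¬¬-minimum : ∀ {ℓ} {P : Pred ℕ ℓ} → ∃ P → ¬ ¬ ∃ (IsMinimum P)
¬¬-minimum {P = P} (n , Pn) noMin = none n Pn
  where
  none : ∀ n → ¬ P n
  none = ℕ.<-rec _ λ n below Pn →
    noMin (n , Pn , λ {m} Pm → ℕ.≮⇒≥ λ m<n → below m<n Pm)

HasWidth : Graph → Pred ℕ _
HasWidth G w = Σ (TreeDecomposition G) λ D → TreeDecomposition.width D ≡ w

IsTreewidth : Graph → Pred ℕ _
IsTreewidth G = IsMinimum (HasWidth G)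

IsBoxicity : Graph → Pred ℕ _
IsBoxicity G = IsMinimum (BoxRepresentation G)

infix 4 tw[_]≤_ box[_]≥_

tw[_]≤_ : Graph → ℕ → Set₁
tw[ G ]≤ k = ∃ λ w → HasWidth G w × w ℕ.≤ k

box[_]≥_ : Graph → ℝ → Set₁
box[ G ]≥ x = ∃ (BoxRepresentation G) × (∀ b → BoxRepresentation G b → x ≤ℝ ℕ→ℝ b)

tw≤-spec : ∀ {G t k} → IsTreewidth G t → tw[ G ]≤ k ⇔ t ℕ.≤ k
tw≤-spec (has , least) =
  mk⇔ (λ (w , hw , w≤k) → ℕ.≤-trans (least hw) w≤k) (λ t≤k → _ , has , t≤k)

box≥-spec : ∀ {G b x} → IsBoxicity G b → box[ G ]≥ x ⇔ x ≤ℝ ℕ→ℝ b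
box≥-spec (rep , least) =
  mk⇔ (λ (_ , bound) → bound _ rep)
      (λ x≤b → (_ , rep) ,
        λ b′ rep′ q Lq → ℚ.<-≤-trans (x≤b q Lq) (ℕ→ℚ-mono-≤ (least rep′)))

{-# OPTIONS --safe #-}
module Submission where

-- Take a clique A on t vertices and, for every colouring c of A with n
-- colours, a clique y(c,1), …, y(c,n) with y(c,i) adjacent to the vertices of A
-- not coloured i.  The star whose leaves carry the bags A ∪ { y(c,i) ∣ i } gives
-- treewidth at most t + n - 1.
--
-- Suppose the graph is represented in b < t dimensions.  In each dimension join
-- the two members of A with the largest left endpoints, and the two with the
-- smallest right endpoints.  This graph on A has at most 2b edges, so it has a
-- proper colouring c with n colours once n (n + 1) > 4b.  Send x ∈ A to a
-- dimension separating x from y(c, c x).  This is injective: two vertices of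
-- different colours cannot share a dimension because, with their partners, they
-- would form an induced C₄ in an interval graph; two vertices of the same colour
-- i cannot share one because the two extreme members of A on that side would then
-- be separated from y(c,i) as well, hence both have colour i.  So t ≤ b after all.
--
-- With r = ⌊√(4k)⌋ the theorem follows by taking t = k - r and n = r + 1.  The
-- order of the reals is not decidable, but t ≤ b is, so finitely many
-- comparisons of endpoints may be assumed decided.

open import Data.Bool.Base using (true; false)
open import Data.Empty using (⊥; ⊥-elim)
open import Data.Fin.Base as Fin using (Fin; zero; suc; _↑ˡ_; _↑ʳ_; splitAt; join; remQuot; combine; punchIn; punchOut; inject≤; finToFun; funToFin)
import Data.Fin.Properties as Fin
open import Data.Fin.Subset as Subset using (Subset; ∣_∣; _∈_; _∪_; ⁅_⁆)
import Data.Fin.Subset.Properties as Subset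
import Data.Integer.Base as ℤ
import Data.Integer.Properties as ℤ
open import Data.Nat.Base as ℕ using (ℕ; zero; suc; z≤n; s≤s; NonZero)
import Data.Nat.Properties as ℕ
open import Data.Nat.Solver using (module +-*-Solver)
open import Data.Product.Base using (∃; ∃₂; _×_; _,_; proj₁; proj₂; uncurry)
open import Data.Rational.Base as ℚ using (ℚ; 0ℚ; 1ℚ; 1/_; _*_; _+_; _-_; _≤_; _<_)
import Data.Rational.Properties as ℚ
import Data.Rational.Solver as ℚ
import Data.Rational.Unnormalised.Base as ℚᵘ
import Data.Rational.Unnormalised.Properties as ℚᵘ
open import Data.Sum.Base as Sum using (_⊎_; inj₁; inj₂; [_,_]′)
open import Data.Unit.Base using (tt)
open import Data.Vec.Base using ([]; _∷_)
import Data.Vec.Functional as Vector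
open import Function.Base using (_∘_; id; flip)
open import Function.Bundles using (mk⇔; Equivalence)
open import Function.Definitions using (Injective)
open import Level using (0ℓ)
open import Relation.Binary.Construct.Closure.ReflexiveTransitive using (Star; ε; _◅_; _◅◅_)
open import Relation.Binary.Core using (Rel)
open import Relation.Binary.Definitions using (Decidable; Transitive; Total)
open import Relation.Binary.PropositionalEquality
open import Relation.Nullary.Decidable.Core using (Dec; yes; no; ¬?; _×-dec_; _⊎-dec_; decidable-stable; ¬¬-excluded-middle)
open import Relation.Nullary.Negation.Core using (¬_; contradiction; ¬¬-map)
open import Defs

-- Proper colourings of graphs with few edges.

glue : ∀ {q} {i j : Fin (suc q)} → i ≢ j → Fin (suc q) → Fin q
glue {i = i} i≢j x with i Fin.≟ x
-- Colour `i` goes where `j` goes; the others only close the gap left by `i`.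
... | yes _   = punchOut i≢j
... | no  i≢x = punchOut i≢x

glue-≡ : ∀ {q} {i j : Fin (suc q)} (i≢j : i ≢ j) x y → glue i≢j x ≡ glue i≢j y →
         x ≡ y ⊎ (x ≡ i × y ≡ j) ⊎ (x ≡ j × y ≡ i)
glue-≡ {i = i} i≢j x y eq with i Fin.≟ x | i Fin.≟ y
... | yes i≡x | yes i≡y = inj₁ (trans (sym i≡x) i≡y)
... | yes i≡x | no  i≢y = inj₂ (inj₁ (sym i≡x , sym (Fin.punchOut-injective i≢j i≢y eq)))
... | no  i≢x | yes i≡y = inj₂ (inj₂ (Fin.punchOut-injective i≢x i≢j eq , sym i≡y))
... | no  i≢x | no  i≢y = inj₁ (Fin.punchOut-injective i≢x i≢y eq)

module _ {t m : ℕ} (u v : Fin m → Fin t) where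

  -- The edges form a list of `m` pairs, possibly with repetitions; a loop imposes no condition.
  Proper : ∀ {q} → (Fin t → Fin q) → Set
  Proper c = ∀ e → u e ≢ v e → c (u e) ≢ c (v e)

  Joins : ∀ {q} → (Fin t → Fin q) → Fin q → Fin q → Fin m → Set
  Joins c i j e = (c (u e) ≡ i × c (v e) ≡ j) ⊎ (c (u e) ≡ j × c (v e) ≡ i)

  joins? : ∀ {q} (c : Fin t → Fin q) i j e → Dec (Joins c i j e)
  joins? c i j e = (c (u e) Fin.≟ i ×-dec c (v e) Fin.≟ j) ⊎-dec (c (u e) Fin.≟ j ×-dec c (v e) Fin.≟ i)

  -- Each edge joins at most two ordered pairs of classes.
  complete⇒≤ : ∀ {q} (c : Fin t → Fin (suc q)) →
               (∀ i j → i ≢ j → ∃ (Joins c i j)) → suc q ℕ.* q ℕ.≤ m ℕ.+ m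
  complete⇒≤ {q} c joined = Fin.injective⇒≤ {f = φ} φ-injective
    where
    Pair : Set
    Pair = Fin (suc q) × Fin (suc q)

    enter : ∀ {i j} → ∃ (Joins c i j) → Fin (m ℕ.+ m)
    enter (e , inj₁ _) = e ↑ˡ m
    enter (e , inj₂ _) = m ↑ʳ e

    -- A left inverse of `enter`: the two halves of `Fin (m + m)` stand for the two orientations of
    -- each edge.
    ends : Fin (m ℕ.+ m) → Pair
    ends = [ (λ e → c (u e) , c (v e)) , (λ e → c (v e) , c (u e)) ]′ ∘ splitAt m

    ends-enter : ∀ {i j} (x : ∃ (Joins c i j)) → ends (enter x) ≡ (i , j)
    ends-enter (e , inj₁ (p , q)) rewrite Fin.splitAt-↑ˡ m e m = cong₂ _,_ p q
    ends-enter (e , inj₂ (p , q)) rewrite Fin.splitAt-↑ʳ m m e = cong₂ _,_ q p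

    -- `punchIn i` runs through the colours other than `i`, so `suc q * q` counts the ordered pairs
    -- of distinct colours.
    edge : ∀ i j → ∃ (Joins c i (punchIn i j))
    edge i j = joined i (punchIn i j) (Fin.punchInᵢ≢i i j ∘ sym)

    φ : Fin (suc q ℕ.* q) → Fin (m ℕ.+ m)
    φ z = let i , j = remQuot {suc q} q z in enter (edge i j)

    φ-injective : Injective _≡_ _≡_ φ
    φ-injective {y} {z} eq = begin
      y                                    ≡⟨ Fin.combine-remQuot {suc q} q y ⟨
      uncurry combine (remQuot {suc q} q y)
        ≡⟨ cong (uncurry combine) (pair-≡ (remQuot {suc q} q y) (remQuot {suc q} q z) eq) ⟩
      uncurry combine (remQuot {suc q} q z) ≡⟨ Fin.combine-remQuot {suc q} q z ⟩
      z                                    ∎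
      where
      open ≡-Reasoning
      pair-≡ : ∀ x y → enter (uncurry edge x) ≡ enter (uncurry edge y) → x ≡ y
      pair-≡ (i , j) (i′ , j′) eq
        with eq′ ← trans (sym (ends-enter (edge i j))) (trans (cong ends eq) (ends-enter (edge i′ j′)))
        with refl ← cong proj₁ eq′ = cong (i ,_) (Fin.punchIn-injective i j j′ (cong proj₂ eq′))

  -- Two colour classes without an edge between them can be merged.
  recolour : ∀ {n} → m ℕ.+ m ℕ.< suc n ℕ.* n → ∀ {q} (c : Fin t → Fin q) → Proper c →
             ∃ λ (c′ : Fin t → Fin n) → Proper c′
  recolour {n} few {q} c proper with q ℕ.≤? n
  ... | yes q≤n = (λ x → inject≤ (c x) q≤n) , λ e u≢v → proper e u≢v ∘ Fin.inject≤-injective q≤n q≤n _ _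
  recolour few {zero} c proper | no q≰n = contradiction z≤n q≰n
  recolour few {suc q} c proper | no q≰n
    with Fin.any? (λ i → Fin.any? λ j → ¬? (i Fin.≟ j) ×-dec ¬? (Fin.any? (joins? c i j)))
  ... | yes (i , j , i≢j , unjoined) = recolour few (glue i≢j ∘ c) λ e u≢v eq →
          [ proper e u≢v , (λ p → unjoined (e , p)) ]′ (glue-≡ i≢j _ _ eq)
  ... | no  complete = contradiction
          (complete⇒≤ c λ i j i≢j → decidable-stable (Fin.any? (joins? c i j))
            λ unjoined → complete (i , j , i≢j , unjoined))
          -- As `n ≤ q`, the `suc q * q` ordered pairs of classes outnumber the `m + m` oriented
          -- edges.
          (ℕ.<⇒≱ (ℕ.<-≤-trans few (ℕ.*-mono-≤ (ℕ.≰⇒> q≰n) (ℕ.≤-pred (ℕ.≰⇒> q≰n)))))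

  -- Merging starts from the colouring in which every vertex has its own colour.
  colouring : ∀ {n} → m ℕ.+ m ℕ.< suc n ℕ.* n → ∃ λ (c : Fin t → Fin n) → Proper c
  colouring few = recolour few id (λ _ → id)

-- Largest elements of finite total preorders.

maximum : ∀ {m} {R : Rel (Fin (suc m)) 0ℓ} → Total R → Transitive R →
          ∃ λ f → ∀ x → R x f
maximum {zero} {R} total tr = zero , λ { zero → [ id , id ]′ (total zero zero) }
maximum {suc m} {R} total tr with maximum {R = λ x y → R (suc x) (suc y)} (λ x y → total _ _) tr
... | f , top with total zero (suc f)
...   | inj₁ 0≤f = suc f , λ { zero → 0≤f ; (suc x) → top x }
...   | inj₂ f≤0 = zero , λ { zero → [ id , id ]′ (total zero zero) ; (suc x) → tr (top x) f≤0 }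

-- Take `g` to be a maximum once `f` is removed; of two distinct elements at most one is `f`, so one
-- of them lies below `g`. Hence an upward closed property of two distinct elements passes to both
-- `f` and `g`.
topTwo : ∀ {m} → 2 ℕ.≤ m → {R : Rel (Fin m) 0ℓ} → Total R → Transitive R →
         ∃₂ λ f g → f ≢ g × (∀ {x y} → x ≢ y → R x f × (R x g ⊎ R y g))
topTwo (s≤s (s≤s _)) {R} total tr
  with f , top₁ ← maximum total tr
  with g , top₂ ← maximum {R = λ x y → R (punchIn f x) (punchIn f y)} (λ x y → total _ _) tr
  = f , punchIn f g , Fin.punchInᵢ≢i f g ∘ sym , λ {x} {y} x≢y → top₁ x , second x≢y
  where
  below : ∀ {x} → f ≢ x → R x (punchIn f g)
  below f≢x = subst (λ z → R z (punchIn f g)) (Fin.punchIn-punchOut f≢x) (top₂ (punchOut f≢x))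
  second : ∀ {x y} → x ≢ y → R x (punchIn f g) ⊎ R y (punchIn f g)
  second {x} {y} x≢y with f Fin.≟ x
  ... | no  f≢x  = inj₁ (below f≢x)
  ... | yes refl = inj₂ (below x≢y)

-- Cardinalities of unions and images.

∣p∪q∣≤∣p∣+∣q∣ : ∀ {n} (p q : Subset n) → ∣ p ∪ q ∣ ℕ.≤ ∣ p ∣ ℕ.+ ∣ q ∣
∣p∪q∣≤∣p∣+∣q∣ []          []          = z≤n
∣p∪q∣≤∣p∣+∣q∣ (false ∷ p) (false ∷ q) = ∣p∪q∣≤∣p∣+∣q∣ p q
∣p∪q∣≤∣p∣+∣q∣ (false ∷ p) (true  ∷ q) =
  ℕ.≤-trans (s≤s (∣p∪q∣≤∣p∣+∣q∣ p q)) (ℕ.≤-reflexive (sym (ℕ.+-suc ∣ p ∣ ∣ q ∣)))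
∣p∪q∣≤∣p∣+∣q∣ (true  ∷ p) (false ∷ q) = s≤s (∣p∪q∣≤∣p∣+∣q∣ p q)
∣p∪q∣≤∣p∣+∣q∣ (true  ∷ p) (true  ∷ q) =
  s≤s (ℕ.≤-trans (∣p∪q∣≤∣p∣+∣q∣ p q) (ℕ.+-monoʳ-≤ ∣ p ∣ (ℕ.n≤1+n ∣ q ∣)))

image : ∀ {m n} → (Fin m → Fin n) → Subset n
image {zero}  f = Subset.⊥
image {suc m} f = ⁅ f zero ⁆ ∪ image (f ∘ suc)

∈-image⁺ : ∀ {m n} (f : Fin m → Fin n) i → f i ∈ image f
∈-image⁺ f zero    = Subset.x∈p∪q⁺ (inj₁ (Subset.x∈⁅x⁆ (f zero)))
∈-image⁺ f (suc i) = Subset.x∈p∪q⁺ (inj₂ (∈-image⁺ (f ∘ suc) i))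

∈-image⁻ : ∀ {m n} (f : Fin m → Fin n) {x} → x ∈ image f → ∃ λ i → x ≡ f i
∈-image⁻ {zero}  f x∈ = contradiction x∈ Subset.∉⊥
∈-image⁻ {suc m} f x∈ with Subset.x∈p∪q⁻ ⁅ f zero ⁆ _ x∈
... | inj₁ x∈⁅⁆ = zero , Subset.x∈⁅y⁆⇒x≡y _ x∈⁅⁆
... | inj₂ x∈im = let i , eq = ∈-image⁻ (f ∘ suc) x∈im in suc i , eq

∣image∣≤ : ∀ {m n} (f : Fin m → Fin n) → ∣ image f ∣ ℕ.≤ m
∣image∣≤ {zero}  {n} f = ℕ.≤-reflexive (Subset.∣⊥∣≡0 n)
∣image∣≤ {suc m} f = ℕ.≤-trans (∣p∪q∣≤∣p∣+∣q∣ ⁅ f zero ⁆ (image (f ∘ suc)))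
  (ℕ.+-mono-≤ (ℕ.≤-reflexive (Subset.∣⁅x⁆∣≡1 (f zero))) (∣image∣≤ (f ∘ suc)))

foldr-⊔-≤ : ∀ {m b} (f : Fin m → ℕ) → (∀ i → f i ℕ.≤ b) → Vector.foldr ℕ._⊔_ 0 f ℕ.≤ b
foldr-⊔-≤ {zero}  f f≤b = z≤n
foldr-⊔-≤ {suc m} f f≤b = ℕ.⊔-lub (f≤b zero) (foldr-⊔-≤ (f ∘ suc) (f≤b ∘ suc))

-- Stars as trees.

module _ (N : ℕ) where

  data Spoke : Rel (Fin (suc N)) 0ℓ where
    out    : ∀ {c} → Spoke zero (suc c)
    inward : ∀ {c} → Spoke (suc c) zero

  spoke? : Decidable Spoke
  spoke? zero    zero    = no λ ()
  spoke? zero    (suc _) = yes out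
  spoke? (suc _) zero    = yes inward
  spoke? (suc _) (suc _) = no λ ()

  star : Graph
  star = record
    { order = suc N
    ; _~_   = Spoke
    ; _~?_  = spoke?
    ; ~-sym = λ { out → inward ; inward → out }
    ; ~-irr = λ ()
    }

  -- Paths run through the centre. This serves both for the star being connected and for the
  -- coherence of bags at core vertices.
  star-connectedOn : ∀ {S : Fin (suc N) → Set} → S zero → Graph.ConnectedOn star S
  star-connectedOn {S} S₀ Su Sv = toCentre Su ◅◅ fromCentre Sv
    where
    Path : Rel (Fin (suc N)) 0ℓ
    Path = Star (λ a b → S a × S b × Spoke a b)

    toCentre : ∀ {u} → S u → Path u zero
    toCentre {zero}  _  = ε
    toCentre {suc _} Su = (Su , S₀ , inward) ◅ ε

    fromCentre : ∀ {v} → S v → Path zero v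
    fromCentre {zero}  _  = ε
    fromCentre {suc _} Sv = (S₀ , Sv , out) ◅ ε

  -- Two consecutive edges of a cycle meet in the centre, so the edge of the
  -- cycle that avoids their common vertex is no spoke.
  star-isTree : Graph.IsTree star
  star-isTree = record
    { nonEmpty  = _
    ; connected = star-connectedOn tt
    ; acyclic   = acyclic
    }
    where
    spoke-centre : ∀ {x y} → Spoke x y → x ≡ zero ⊎ y ≡ zero
    spoke-centre out    = inj₁ refl
    spoke-centre inward = inj₂ refl

    acyclic : ¬ Graph.Cycle star
    acyclic C = go (spoke-centre (step zero)) (spoke-centre (step (suc zero))) (spoke-centre close)
      where
      open Graph.Cycle C
      clash : ∀ {i j} → i ≢ j → at i ≡ zero → at j ≡ zero → ⊥
      clash i≢j p q = i≢j (distinct (trans p (sym q)))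
      go : ∀ {i} → at zero ≡ zero ⊎ at (suc zero) ≡ zero →
           at (suc zero) ≡ zero ⊎ at (suc (suc zero)) ≡ zero →
           at (suc (suc i)) ≡ zero ⊎ at zero ≡ zero → ⊥
      go (inj₁ p) (inj₁ q) _        = clash (λ ()) p q
      go (inj₁ p) (inj₂ q) _        = clash (λ ()) p q
      go (inj₂ p) _        (inj₁ q) = clash (λ ()) p q
      go (inj₂ p) _        (inj₂ q) = clash (λ ()) p q

-- The graph and its tree decomposition.

module ColouringGraph (t n : ℕ) where

  -- The number of colourings of the core; `finToFun` reads an index as a colouring.
  N : ℕ
  N = n ℕ.^ t

  -- `inj₁ a` is a member of the core clique, `inj₂ (c , i)` the vertex y(c,i).
  Label : Set
  Label = Fin t ⊎ (Fin N × Fin n)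

  size : ℕ
  size = t ℕ.+ N ℕ.* n

  encode : Label → Fin size
  encode = join t (N ℕ.* n) ∘ Sum.map₂ (uncurry combine)

  decode : Fin size → Label
  decode = Sum.map₂ (remQuot n) ∘ splitAt t

  decode-encode : ∀ w → decode (encode w) ≡ w
  decode-encode (inj₁ a)       = cong (Sum.map₂ (remQuot n)) (Fin.splitAt-↑ˡ t a (N ℕ.* n))
  decode-encode (inj₂ (c , i)) = trans (cong (Sum.map₂ (remQuot n)) (Fin.splitAt-↑ʳ t (N ℕ.* n) (combine c i)))
    (cong inj₂ (Fin.remQuot-combine c i))

  encode-decode : ∀ v → encode (decode v) ≡ v
  encode-decode v = trans (lemma (splitAt t v)) (Fin.join-splitAt t (N ℕ.* n) v)
    where
    lemma : ∀ s → encode (Sum.map₂ (remQuot n) s) ≡ join t (N ℕ.* n) s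
    lemma (inj₁ a) = refl
    lemma (inj₂ z) = cong (t ↑ʳ_) (Fin.combine-remQuot {N} n z)

  encode-injective : ∀ w w′ → encode w ≡ encode w′ → w ≡ w′
  encode-injective w w′ eq = trans (sym (decode-encode w)) (trans (cong decode eq) (decode-encode w′))

  Adj : Rel Label 0ℓ
  Adj (inj₁ a)       (inj₁ a′)        = a ≢ a′
  Adj (inj₁ a)       (inj₂ (c , i))   = finToFun c a ≢ i
  Adj (inj₂ (c , i)) (inj₁ a)         = finToFun c a ≢ i
  Adj (inj₂ (c , i)) (inj₂ (c′ , i′)) = c ≡ c′ × i ≢ i′

  adj? : Decidable Adj
  adj? (inj₁ a)       (inj₁ a′)        = ¬? (a Fin.≟ a′)
  adj? (inj₁ a)       (inj₂ (c , i))   = ¬? (finToFun c a Fin.≟ i)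
  adj? (inj₂ (c , i)) (inj₁ a)         = ¬? (finToFun c a Fin.≟ i)
  adj? (inj₂ (c , i)) (inj₂ (c′ , i′)) = c Fin.≟ c′ ×-dec ¬? (i Fin.≟ i′)

  adj-sym : ∀ w w′ → Adj w w′ → Adj w′ w
  adj-sym (inj₁ a)       (inj₁ a′)        = ≢-sym
  adj-sym (inj₁ a)       (inj₂ (c , i))   = id
  adj-sym (inj₂ (c , i)) (inj₁ a)         = id
  adj-sym (inj₂ (c , i)) (inj₂ (c′ , i′)) (c≡ , i≢) = sym c≡ , ≢-sym i≢

  adj-irr : ∀ w → ¬ Adj w w
  adj-irr (inj₁ a)       a≢a       = a≢a refl
  adj-irr (inj₂ (c , i)) (_ , i≢i) = i≢i refl

  graph : Graph
  graph = record
    { order = size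
    ; _~_   = λ u v → Adj (decode u) (decode v)
    ; _~?_  = λ u v → adj? (decode u) (decode v)
    ; ~-sym = λ {u} {v} → adj-sym (decode u) (decode v)
    ; ~-irr = λ {v} → adj-irr (decode v)
    }

  core : Subset size
  core = image (encode ∘ inj₁)

  part : Fin N → Subset size
  part c = image (λ i → encode (inj₂ (c , i)))

  -- The centre carries the core alone, so a core vertex lies in every bag and any other vertex in
  -- the bag of exactly one leaf.
  bag : Fin (suc N) → Subset size
  bag zero    = core
  bag (suc c) = core ∪ part c

  core⊆bag : ∀ a i → encode (inj₁ a) ∈ bag i
  core⊆bag a zero    = ∈-image⁺ (encode ∘ inj₁) a
  core⊆bag a (suc c) = Subset.x∈p∪q⁺ (inj₁ (∈-image⁺ (encode ∘ inj₁) a))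

  part⊆bag : ∀ c i → encode (inj₂ (c , i)) ∈ bag (suc c)
  part⊆bag c i = Subset.x∈p∪q⁺ {p = core} (inj₂ (∈-image⁺ (λ i → encode (inj₂ (c , i))) i))

  part∩core : ∀ {w} → ¬ encode (inj₂ w) ∈ core
  part∩core w∈ with a , eq ← ∈-image⁻ (encode ∘ inj₁) w∈ with () ← encode-injective (inj₂ _) (inj₁ a) eq

  ∈bag⇒≡ : ∀ {c i} j → encode (inj₂ (c , i)) ∈ bag j → j ≡ suc c
  ∈bag⇒≡ zero     w∈ = contradiction w∈ part∩core
  ∈bag⇒≡ (suc c′) w∈ with Subset.x∈p∪q⁻ core (part c′) w∈
  ... | inj₁ w∈core = contradiction w∈core part∩core
  ... | inj₂ w∈part
    with _ , eq ← ∈-image⁻ (λ i → encode (inj₂ (c′ , i))) w∈part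
    with refl ← encode-injective (inj₂ _) (inj₂ _) eq = refl

  ∣bag∣≤ : ∀ i → ∣ bag i ∣ ℕ.≤ t ℕ.+ n
  ∣bag∣≤ zero    = ℕ.≤-trans (∣image∣≤ (encode ∘ inj₁)) (ℕ.m≤m+n t n)
  ∣bag∣≤ (suc c) = ℕ.≤-trans (∣p∪q∣≤∣p∣+∣q∣ core (part c))
    (ℕ.+-mono-≤ (∣image∣≤ (encode ∘ inj₁)) (∣image∣≤ (λ i → encode (inj₂ (c , i)))))

  decomposition : TreeDecomposition graph
  decomposition = record
    { T        = star N
    ; isTree   = star-isTree N
    ; bag      = bag
    ; coverV   = λ v → subst (λ v → ∃ λ i → v ∈ bag i) (encode-decode v) (coverV (decode v))
    ; coverE   = λ {u} {v} u~v → subst₂ (λ u v → ∃ λ i → u ∈ bag i × v ∈ bag i)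
                   (encode-decode u) (encode-decode v) (coverE (decode u) (decode v) u~v)
    ; coherent = λ v → subst (λ v → Graph.ConnectedOn (star N) (λ i → v ∈ bag i))
                   (encode-decode v) (coherent (decode v))
    }
    where
    coverV : ∀ w → ∃ λ i → encode w ∈ bag i
    coverV (inj₁ a)       = zero , core⊆bag a zero
    coverV (inj₂ (c , i)) = suc c , part⊆bag c i

    coverE : ∀ w w′ → Adj w w′ → ∃ λ i → encode w ∈ bag i × encode w′ ∈ bag i
    coverE (inj₁ a)       (inj₁ a′)       _          = zero , core⊆bag a zero , core⊆bag a′ zero
    coverE (inj₁ a)       (inj₂ (c , i))  _          = suc c , core⊆bag a (suc c) , part⊆bag c i
    coverE (inj₂ (c , i)) (inj₁ a)        _          = suc c , part⊆bag c i , core⊆bag a (suc c)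
    coverE (inj₂ (c , i)) (inj₂ (_ , i′)) (refl , _) = suc c , part⊆bag c i , part⊆bag c i′

    coherent : ∀ w → Graph.ConnectedOn (star N) (λ i → encode w ∈ bag i)
    coherent (inj₁ a) = star-connectedOn N (core⊆bag a zero)
    coherent (inj₂ w) {i} {j} ∈i ∈j
      with refl ← ∈bag⇒≡ i ∈i with refl ← ∈bag⇒≡ j ∈j = ε

  tw≤ : ∀ {k} → t ℕ.+ n ℕ.≤ suc k → tw[ graph ]≤ k
  tw≤ t+n≤1+k = _ , (decomposition , refl) ,
    ℕ.∸-monoˡ-≤ 1 (ℕ.≤-trans (foldr-⊔-≤ (λ i → ∣ bag i ∣) ∣bag∣≤) t+n≤1+k)

-- Order of the reals, and existence of box representations.

open ℝ
open Interval

≤ℝ-refl : ∀ {x} → x ≤ℝ x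
≤ℝ-refl q = id

≤ℝ-trans : ∀ {x y z} → x ≤ℝ y → y ≤ℝ z → x ≤ℝ z
≤ℝ-trans x≤y y≤z q = y≤z q ∘ x≤y q

-- Roundedness leaves room between `q` and `r` below `y`, and locatedness puts `x` above `q` or
-- below `r`; the latter would give `x ≤ y`.
≰ℝ⇒≥ℝ : ∀ {x y} → ¬ (x ≤ℝ y) → y ≤ℝ x
≰ℝ⇒≥ℝ {x} {y} x≰y q Lyq with r , q<r , Lyr ← L-round y Lyq with located x q<r
... | inj₁ Lxq = Lxq
... | inj₂ Uxr = contradiction (λ p Lxp → L-down y (L<U x Lxp Uxr) Lyr) x≰y

ℚ→ℝ-mono : ∀ {p q} → p ℚ.≤ q → ℚ→ℝ p ≤ℝ ℚ→ℝ q
ℚ→ℝ-mono p≤q r r<p = ℚ.<-≤-trans r<p p≤q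

choosePoint : ∀ {b} (B C : Box b) → (∀ d → ∃ λ x → x ∈ᴵ B d × x ∈ᴵ C d) → Meets B C
choosePoint B C common =
  (λ d → proj₁ (common d)) , (λ d → proj₁ (proj₂ (common d))) , (λ d → proj₂ (proj₂ (common d)))

-- One dimension per vertex v: v gets {0}, its neighbours [0, 1], all others {1}.
boxRepresentation : ∀ G → BoxRepresentation G (Graph.order G)
boxRepresentation G = record { box = box ; spec = λ u≢v → mk⇔ (meets u≢v) (adjacent u≢v) }
  where
  open Graph G

  0≤1 : ℚ→ℝ 0ℚ ≤ℝ ℚ→ℝ 1ℚ
  0≤1 = ℚ→ℝ-mono (ℚ.<⇒≤ (ℚ.positive⁻¹ 1ℚ))

  1≰0 : ¬ (ℚ→ℝ 1ℚ ≤ℝ ℚ→ℝ 0ℚ)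
  1≰0 1≤0 = ℚ.<-irrefl refl (1≤0 0ℚ (ℚ.positive⁻¹ 1ℚ))

  box : Vertex → Box order
  box u v with v Fin.≟ u | v ~? u
  ... | yes _ | _     = record { lo = ℚ→ℝ 0ℚ ; hi = ℚ→ℝ 0ℚ ; lo≤hi = ≤ℝ-refl {ℚ→ℝ 0ℚ} }
  ... | no  _ | yes _ = record { lo = ℚ→ℝ 0ℚ ; hi = ℚ→ℝ 1ℚ ; lo≤hi = 0≤1 }
  ... | no  _ | no  _ = record { lo = ℚ→ℝ 1ℚ ; hi = ℚ→ℝ 1ℚ ; lo≤hi = ≤ℝ-refl {ℚ→ℝ 1ℚ} }

  0∈self : ∀ u → ℚ→ℝ 0ℚ ∈ᴵ box u u
  0∈self u with u Fin.≟ u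
  ... | yes _   = ≤ℝ-refl {ℚ→ℝ 0ℚ} , ≤ℝ-refl {ℚ→ℝ 0ℚ}
  ... | no  u≢u = contradiction refl u≢u

  0∈nbr : ∀ {u v} → v ~ u → ℚ→ℝ 0ℚ ∈ᴵ box u v
  0∈nbr {u} {v} v~u with v Fin.≟ u | v ~? u
  ... | yes _ | _       = ≤ℝ-refl {ℚ→ℝ 0ℚ} , ≤ℝ-refl {ℚ→ℝ 0ℚ}
  ... | no  _ | yes _   = ≤ℝ-refl {ℚ→ℝ 0ℚ} , 0≤1
  ... | no  _ | no  v≁u = contradiction v~u v≁u

  1∈other : ∀ {u v} → v ≢ u → ℚ→ℝ 1ℚ ∈ᴵ box u v
  1∈other {u} {v} v≢u with v Fin.≟ u | v ~? u
  ... | yes v≡u | _     = contradiction v≡u v≢u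
  ... | no  _   | yes _ = 0≤1 , ≤ℝ-refl {ℚ→ℝ 1ℚ}
  ... | no  _   | no  _ = ≤ℝ-refl {ℚ→ℝ 1ℚ} , ≤ℝ-refl {ℚ→ℝ 1ℚ}

  hi-self : ∀ u → hi (box u u) ≡ ℚ→ℝ 0ℚ
  hi-self u with u Fin.≟ u
  ... | yes _   = refl
  ... | no  u≢u = contradiction refl u≢u

  lo-other : ∀ {u v} → v ≢ u → ¬ (v ~ u) → lo (box u v) ≡ ℚ→ℝ 1ℚ
  lo-other {u} {v} v≢u v≁u with v Fin.≟ u | v ~? u
  ... | yes v≡u | _       = contradiction v≡u v≢u
  ... | no  _   | yes v~u = contradiction v~u v≁u
  ... | no  _   | no  _   = refl

  meets : ∀ {u v} → u ≢ v → u ~ v → Meets (box u) (box v)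
  meets {u} {v} u≢v u~v = choosePoint (box u) (box v) λ w → common w (w Fin.≟ u) (w Fin.≟ v)
    where
    common : ∀ w → Dec (w ≡ u) → Dec (w ≡ v) → ∃ λ x → x ∈ᴵ box u w × x ∈ᴵ box v w
    common w (yes refl) _          = ℚ→ℝ 0ℚ , 0∈self u , 0∈nbr u~v
    common w (no _)     (yes refl) = ℚ→ℝ 0ℚ , 0∈nbr (~-sym u~v) , 0∈self v
    common w (no w≢u)   (no w≢v)   = ℚ→ℝ 1ℚ , 1∈other w≢u , 1∈other w≢v

  adjacent : ∀ {u v} → u ≢ v → Meets (box u) (box v) → u ~ v
  adjacent {u} {v} u≢v (p , p∈u , p∈v) with u ~? v
  ... | yes u~v = u~v
  -- In coordinate `u` the boxes of `u` and `v` are {0} and {1}, so a common point would give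
  -- `1 ≤ 0`.
  ... | no  u≁v = contradiction
        (subst₂ _≤ℝ_ (lo-other u≢v u≁v) (hi-self u)
          (≤ℝ-trans {lo (box v u)} {p u} {hi (box u u)} (proj₁ (p∈v u)) (proj₂ (p∈u u))))
        1≰0

-- Configurations of touching and disjoint intervals.

Touch Before Disjoint : Interval → Interval → Set
Touch I J    = lo I ≤ℝ hi J × lo J ≤ℝ hi I
Before I J   = ¬ (lo J ≤ℝ hi I)
Disjoint I J = Before I J ⊎ Before J I

touch⇒¬disjoint : ∀ {I J} → Touch I J → ¬ Disjoint I J
touch⇒¬disjoint (_ , J≤I) (inj₁ I<J) = I<J J≤I
touch⇒¬disjoint (I≤J , _) (inj₂ J<I) = J<I I≤J

-- A negated inequality plays the part of a strict one: `w ≤ x < y ≤ z`.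
chain : ∀ {w x y z} → w ≤ℝ x → ¬ (y ≤ℝ x) → y ≤ℝ z → w ≤ℝ z
chain {w} {x} {y} {z} w≤x y≰x y≤z = ≤ℝ-trans {w} {x} {z} w≤x (≤ℝ-trans {x} {y} {z} (≰ℝ⇒≥ℝ {y} {x} y≰x) y≤z)

-- Both `x′` and `y′` touch `x` and `y`, so both span the gap between these and must touch each
-- other.
noC₄ : ∀ {x x′ y y′} → Touch x x′ → Touch y y′ → Touch x y′ → Touch x′ y →
       Disjoint x y → ¬ Disjoint x′ y′
noC₄ {x} {x′} {y} {y′} (xx′ , x′x) (yy′ , y′y) (xy′ , y′x) (x′y , yx′) = λ where
  (inj₁ x<y) (inj₁ x′<y′) → x<y (chain {lo y} {hi x′} {lo y′} {hi x} yx′ x′<y′ y′x)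
  (inj₁ x<y) (inj₂ y′<x′) → x<y (chain {lo y} {hi y′} {lo x′} {hi x} yy′ y′<x′ x′x)
  (inj₂ y<x) (inj₁ x′<y′) → y<x (chain {lo x} {hi x′} {lo y′} {hi y} xx′ x′<y′ y′y)
  (inj₂ y<x) (inj₂ y′<x′) → y<x (chain {lo x} {hi y′} {lo x′} {hi y} xy′ y′<x′ x′y)

-- Otherwise y would lie strictly between x and x′, which touch.
sameSide : ∀ {x x′ y} → Touch x x′ → Disjoint x y → Disjoint x′ y →
           (Before x y × Before x′ y) ⊎ (Before y x × Before y x′)
sameSide {x} {x′} {y} (xx′ , x′x) = λ where
  (inj₁ x<y) (inj₁ x′<y) → inj₁ (x<y , x′<y)
  (inj₁ x<y) (inj₂ y<x′) → ⊥-elim (x<y (chain {lo y} {hi y} {lo x′} {hi x} (lo≤hi y) y<x′ x′x))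
  (inj₂ y<x) (inj₁ x′<y) → ⊥-elim (y<x (chain {lo x} {hi x′} {lo y} {hi y} xx′ x′<y (lo≤hi y)))
  (inj₂ y<x) (inj₂ y<x′) → inj₂ (y<x , y<x′)

-- Deciding finitely many comparisons of endpoints.

¬¬-∀ : ∀ {n p} {P : Fin n → Set p} → (∀ i → ¬ ¬ P i) → ¬ ¬ (∀ i → P i)
¬¬-∀ {zero}  ¬¬P k = k λ ()
¬¬-∀ {suc n} ¬¬P k = ¬¬P zero λ P₀ → ¬¬-∀ (¬¬P ∘ suc) λ Pₛ → k λ { zero → P₀ ; (suc i) → Pₛ i }

record Comparable (I J : Interval) : Set where
  field
    lo≤lo? : Dec (lo I ≤ℝ lo J)
    hi≤hi? : Dec (hi I ≤ℝ hi J)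
    lo≤hi? : Dec (lo I ≤ℝ hi J)

open Comparable

¬¬-comparable : ∀ I J → ¬ ¬ Comparable I J
¬¬-comparable I J k =
  ¬¬-excluded-middle λ p → ¬¬-excluded-middle λ q → ¬¬-excluded-middle λ r →
  k (record { lo≤lo? = p ; hi≤hi? = q ; lo≤hi? = r })

-- The larger of the two left endpoints is a common point.
meet : ∀ I J → Dec (lo I ≤ℝ lo J) → Touch I J → ∃ λ x → x ∈ᴵ I × x ∈ᴵ J
meet I J (yes I≤J) (_ , J≤I) = lo J , (I≤J , J≤I) , (≤ℝ-refl {lo J} , lo≤hi J)
meet I J (no  I≰J) (I≤J , _) = lo I , (≤ℝ-refl {lo I} , lo≤hi I) , (≰ℝ⇒≥ℝ {lo I} {lo J} I≰J , I≤J)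

dec⇒total : ∀ {m} (f : Fin m → ℝ) → (∀ x y → Dec (f x ≤ℝ f y)) → Total (λ x y → f x ≤ℝ f y)
dec⇒total f f? x y with f? x y
... | yes p = inj₁ p
... | no  p = inj₂ (≰ℝ⇒≥ℝ {f x} {f y} p)

-- The lower bound on boxicity.

module _ (t n b : ℕ) (rep : BoxRepresentation (ColouringGraph.graph t n) b) where

  open ColouringGraph t n
  open BoxRepresentation rep

  I : Label → Fin b → Interval
  I w = box (encode w)

  Decided : Set
  Decided = ∀ u v d → Comparable (box u d) (box v d)

  touching : ∀ {w w′} → Adj w w′ → ∀ d → Touch (I w d) (I w′ d)
  touching {w} {w′} w~w′ d =
    ≤ℝ-trans {lo (I w d)} {p d} {hi (I w′ d)} (proj₁ (p∈ d)) (proj₂ (p∈′ d)) ,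
    ≤ℝ-trans {lo (I w′ d)} {p d} {hi (I w d)} (proj₁ (p∈′ d)) (proj₂ (p∈ d))
    where
    distinct : encode w ≢ encode w′
    distinct eq = adj-irr w′ (subst (λ w → Adj w w′) (encode-injective w w′ eq) w~w′)

    common : Meets (box (encode w)) (box (encode w′))
    common = Equivalence.to (spec distinct)
      (subst₂ Adj (sym (decode-encode w)) (sym (decode-encode w′)) w~w′)

    p   = proj₁ common
    p∈  = proj₁ (proj₂ common)
    p∈′ = proj₂ (proj₂ common)

  core-touching : ∀ a a′ d → Touch (I (inj₁ a) d) (I (inj₁ a′) d)
  core-touching a a′ d with a Fin.≟ a′
  ... | yes refl = lo≤hi (I (inj₁ a) d) , lo≤hi (I (inj₁ a) d)
  ... | no  a≢a′ = touching {inj₁ a} {inj₁ a′} a≢a′ d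

  module _ (decided : Decided) where

    decided′ : ∀ w w′ d → Comparable (I w d) (I w′ d)
    decided′ w w′ = decided (encode w) (encode w′)

    -- Disjointness is built from negated inequalities, so it inherits their decisions; one of them
    -- comes from the record of the reversed pair.
    disjoint? : ∀ w w′ d → Dec (Disjoint (I w d) (I w′ d))
    disjoint? w w′ d = ¬? (lo≤hi? (decided′ w′ w d)) ⊎-dec ¬? (lo≤hi? (decided′ w w′ d))

    -- If the intervals touched in every dimension, common points could be chosen coordinatewise and
    -- the boxes would meet.
    separated : ∀ {w w′} → w ≢ w′ → ¬ Adj w w′ → ∃ λ d → Disjoint (I w d) (I w′ d)
    separated {w} {w′} w≢w′ w≁w′ = decidable-stable (Fin.any? (disjoint? w w′)) λ none →
      let common = λ d → meet (I w d) (I w′ d) (lo≤lo? (decided′ w w′ d))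
            ( decidable-stable (lo≤hi? (decided′ w w′ d)) (λ p → none (d , inj₂ p))
            , decidable-stable (lo≤hi? (decided′ w′ w d)) (λ p → none (d , inj₁ p)))
      in w≁w′ (subst₂ Adj (decode-encode w) (decode-encode w′)
           (Equivalence.from (spec (w≢w′ ∘ encode-injective w w′))
             (choosePoint (I w) (I w′) common)))

    module _ (b<t : b ℕ.< t) where

      -- A dimension shows `1 ≤ b < t`, so the core has two extreme members to choose.
      2≤t : Fin b → 2 ℕ.≤ t
      2≤t d = ℕ.≤-trans (s≤s (ℕ.≤-trans (s≤s z≤n) (Fin.toℕ<n d))) b<t

      los his : Fin b → Fin t → ℝ
      los d a = lo (I (inj₁ a) d)
      his d a = hi (I (inj₁ a) d)

      TopTwo : Rel (Fin t) 0ℓ → Set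
      TopTwo R = ∃₂ λ f g → f ≢ g × (∀ {x y} → x ≢ y → R x f × (R x g ⊎ R y g))

      topLo : ∀ d → TopTwo (λ x y → los d x ≤ℝ los d y)
      topLo d = topTwo (2≤t d) (dec⇒total (los d) λ x y → lo≤lo? (decided′ (inj₁ x) (inj₁ y) d))
                  λ {x} {y} {z} → ≤ℝ-trans {los d x} {los d y} {los d z}

      -- The order is reversed: these are the two smallest right endpoints.
      topHi : ∀ d → TopTwo (λ x y → his d y ≤ℝ his d x)
      topHi d = topTwo (2≤t d) (flip (dec⇒total (his d) λ x y → hi≤hi? (decided′ (inj₁ x) (inj₁ y) d)))
                  λ {x} {y} {z} p q → ≤ℝ-trans {his d z} {his d y} {his d x} q p

      -- The ends of the edges to be coloured: the first `b` come from left endpoints, the others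
      -- from right endpoints.
      first second : Fin (b ℕ.+ b) → Fin t
      first  = [ proj₁ ∘ topLo , proj₁ ∘ topHi ]′ ∘ splitAt b
      second = [ proj₁ ∘ proj₂ ∘ topLo , proj₁ ∘ proj₂ ∘ topHi ]′ ∘ splitAt b

      module _ (c : Fin t → Fin n) (proper : Proper first second c) where

        y : Fin n → Label
        y i = inj₂ (funToFin c , i)

        colour-≡ : ∀ a → finToFun (funToFin c) a ≡ c a
        colour-≡ = Fin.finToFun-funToFin c

        -- A core vertex not coloured `i` is adjacent to `y i` and touches it in every dimension.
        disjoint⇒colour : ∀ a {i d} → Disjoint (I (inj₁ a) d) (I (y i) d) → c a ≡ i
        disjoint⇒colour a {i} {d} a|y = decidable-stable (c a Fin.≟ i) λ ca≢i →
          touch⇒¬disjoint {I (inj₁ a) d} {I (y i) d} (touching {inj₁ a} {y i} (ca≢i ∘ trans (sym (colour-≡ a))) d) a|y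

        properLo : ∀ d → c (proj₁ (topLo d)) ≢ c (proj₁ (proj₂ (topLo d)))
        properLo d with pr ← proper (d ↑ˡ b) rewrite Fin.splitAt-↑ˡ b d b = pr (proj₁ (proj₂ (proj₂ (topLo d))))

        properHi : ∀ d → c (proj₁ (topHi d)) ≢ c (proj₁ (proj₂ (topHi d)))
        properHi d with pr ← proper (b ↑ʳ d) rewrite Fin.splitAt-↑ʳ b b d = pr (proj₁ (proj₂ (proj₂ (topHi d))))

        sameColour : ∀ {x x′ i d} → x ≢ x′ → Disjoint (I (inj₁ x) d) (I (y i) d) →
                     ¬ Disjoint (I (inj₁ x′) d) (I (y i) d)
        sameColour {x} {x′} {i} {d} x≢x′ x|y x′|y
          with sameSide {I (inj₁ x) d} {I (inj₁ x′) d} {I (y i) d} (core-touching x x′ d) x|y x′|y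
        -- `x` and `x′` end before `y i` begins, so the two core members with smallest right
        -- endpoints do too and both have colour `i`.
        ... | inj₁ (x<y , x′<y) = properHi d (trans (disjoint⇒colour f (inj₁ f<y)) (sym (disjoint⇒colour g (inj₁ g<y))))
          where
          f = proj₁ (topHi d)
          g = proj₁ (proj₂ (topHi d))
          top = proj₂ (proj₂ (proj₂ (topHi d))) x≢x′
          down : ∀ {a a′} → his d a′ ≤ℝ his d a → Before (I (inj₁ a) d) (I (y i) d) → Before (I (inj₁ a′) d) (I (y i) d)
          down {a} {a′} a′≤a a<y y≤a′ = a<y (≤ℝ-trans {lo (I (y i) d)} {his d a′} {his d a} y≤a′ a′≤a)
          f<y = down (proj₁ top) x<y
          g<y = [ (λ p → down p x<y) , (λ p → down p x′<y) ]′ (proj₂ top)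
        ... | inj₂ (y<x , y<x′) = properLo d (trans (disjoint⇒colour f (inj₂ y<f)) (sym (disjoint⇒colour g (inj₂ y<g))))
          where
          f = proj₁ (topLo d)
          g = proj₁ (proj₂ (topLo d))
          top = proj₂ (proj₂ (proj₂ (topLo d))) x≢x′
          up : ∀ {a a′} → los d a ≤ℝ los d a′ → Before (I (y i) d) (I (inj₁ a) d) → Before (I (y i) d) (I (inj₁ a′) d)
          up {a} {a′} a≤a′ y<a a′≤y = y<a (≤ℝ-trans {los d a} {los d a′} {hi (I (y i) d)} a≤a′ a′≤y)
          y<f = up (proj₁ top) y<x
          y<g = [ (λ p → up p y<x) , (λ p → up p y<x′) ]′ (proj₂ top)

        separator : ∀ x → ∃ λ d → Disjoint (I (inj₁ x) d) (I (y (c x)) d)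
        separator x = separated {inj₁ x} {y (c x)} (λ ()) λ cx≢ → cx≢ (colour-≡ x)

        separator-injective : Injective _≡_ _≡_ (proj₁ ∘ separator)
        separator-injective {x} {x′} eq with x Fin.≟ x′
        ... | yes x≡x′ = x≡x′
        ... | no  x≢x′ with separator x | separator x′
        ...   | d , x|y | d′ , x′|y′ with refl ← eq with c x Fin.≟ c x′
        ...     | yes same = contradiction (subst (λ i → Disjoint (I (inj₁ x′) d) (I (y i) d)) (sym same) x′|y′)
                               (sameColour x≢x′ x|y)
        -- The four-cycle is `x`, `x′`, `y (c x)`, `y (c x′)` in this order; all its edges exist
        -- because the colours differ.
        ...     | no  differ = contradiction x′|y′
                    (noC₄ {I (inj₁ x) d} {I (inj₁ x′) d} {I (y (c x)) d} {I (y (c x′)) d}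
                      (core-touching x x′ d)
                      (touching {y (c x)} {y (c x′)} (refl , differ) d)
                      (touching {inj₁ x} {y (c x′)} (differ ∘ trans (sym (colour-≡ x))) d)
                      (touching {inj₁ x′} {y (c x)} (differ ∘ sym ∘ trans (sym (colour-≡ x′))) d) x|y)

      -- The `b + b` edges are counted in both orientations, whence 4b.
      contradictory : b ℕ.+ b ℕ.+ (b ℕ.+ b) ℕ.< suc n ℕ.* n → ⊥
      contradictory few = let c , proper = colouring first second few in
        ℕ.<⇒≱ b<t (Fin.injective⇒≤ (separator-injective c proper))

  -- The slack of 3 is harmless: `b < t` gives `4 + 4b ≤ 4t`, which leaves `4b < suc n * n`.
  boxicity≥ : 4 ℕ.* t ℕ.≤ 3 ℕ.+ suc n ℕ.* n → t ℕ.≤ b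
  -- The goal is decidable, hence stable, and double negation commutes with finite quantification,
  -- so all comparisons may be taken as decided.
  boxicity≥ 4t≤ = decidable-stable (t ℕ.≤? b) (¬¬-map dim≥
    (¬¬-∀ λ u → ¬¬-∀ λ v → ¬¬-∀ λ d → ¬¬-comparable (box u d) (box v d)))
    where
    4b<4t : b ℕ.< t → 4 ℕ.+ (b ℕ.+ b ℕ.+ (b ℕ.+ b)) ℕ.≤ 4 ℕ.* t
    4b<4t b<t = ℕ.≤-trans (ℕ.≤-reflexive eq) (ℕ.*-monoʳ-≤ 4 b<t)
      where
      open +-*-Solver
      eq : 4 ℕ.+ (b ℕ.+ b ℕ.+ (b ℕ.+ b)) ≡ 4 ℕ.* suc b
      eq = solve 1 (λ b → con 4 :+ (b :+ b :+ (b :+ b)) := con 4 :* (con 1 :+ b)) refl b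

    dim≥ : Decided → t ℕ.≤ b
    dim≥ decided = ℕ.≮⇒≥ λ b<t →
      contradictory decided b<t (ℕ.+-cancelˡ-≤ 3 _ _ (ℕ.≤-trans (4b<4t b<t) 4t≤))

-- Integer square roots and the real bound.

isqrt : ∀ m → ∃ λ r → r ℕ.* r ℕ.≤ m × m ℕ.< suc r ℕ.* suc r
isqrt zero = 0 , z≤n , s≤s z≤n
isqrt (suc m) with r , r²≤m , m<[1+r]² ← isqrt m with suc r ℕ.* suc r ℕ.≤? suc m
... | yes [1+r]²≤1+m = suc r , [1+r]²≤1+m ,
        ℕ.≤-<-trans m<[1+r]² (ℕ.*-mono-< (ℕ.n<1+n (suc r)) (ℕ.n<1+n (suc r)))
... | no  [1+r]²≰1+m = r , ℕ.m≤n⇒m≤1+n r²≤m , ℕ.≰⇒> [1+r]²≰1+m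

private
  intᵘ : ℕ → ℚᵘ.ℚᵘ
  intᵘ n = ℚᵘ.mkℚᵘ (ℤ.+ n) 0

-- Verified on unnormalised fractions with denominator 1, where no common factors are cancelled.
ℕ→ℚ-+ : ∀ m n → ℕ→ℚ (m ℕ.+ n) ≡ ℕ→ℚ m + ℕ→ℚ n
ℕ→ℚ-+ m n = ℚ.toℚᵘ-injective (begin
  ℚ.toℚᵘ (ℕ→ℚ (m ℕ.+ n))                    ≈⟨ ℚ.toℚᵘ-fromℚᵘ (intᵘ (m ℕ.+ n)) ⟩
  intᵘ (m ℕ.+ n)                            ≈⟨ ℚᵘ.*≡* (cong (ℤ._* ℤ.1ℤ)
                                                 (sym (cong₂ ℤ._+_ (ℤ.*-identityʳ (ℤ.+ m)) (ℤ.*-identityʳ (ℤ.+ n))))) ⟩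
  intᵘ m ℚᵘ.+ intᵘ n                        ≈⟨ ℚᵘ.+-cong (ℚ.toℚᵘ-fromℚᵘ (intᵘ m)) (ℚ.toℚᵘ-fromℚᵘ (intᵘ n)) ⟨
  ℚ.toℚᵘ (ℕ→ℚ m) ℚᵘ.+ ℚ.toℚᵘ (ℕ→ℚ n)        ≈⟨ ℚ.toℚᵘ-homo-+ (ℕ→ℚ m) (ℕ→ℚ n) ⟨
  ℚ.toℚᵘ (ℕ→ℚ m + ℕ→ℚ n)                    ∎)
  where open import Relation.Binary.Reasoning.Setoid ℚᵘ.≃-setoid

ℕ→ℚ-* : ∀ m n → ℕ→ℚ (m ℕ.* n) ≡ ℕ→ℚ m * ℕ→ℚ n
ℕ→ℚ-* m n = ℚ.toℚᵘ-injective (begin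
  ℚ.toℚᵘ (ℕ→ℚ (m ℕ.* n))                    ≈⟨ ℚ.toℚᵘ-fromℚᵘ (intᵘ (m ℕ.* n)) ⟩
  intᵘ (m ℕ.* n)                            ≈⟨ ℚᵘ.*≡* (cong (ℤ._* ℤ.1ℤ) (ℤ.pos-* m n)) ⟩
  intᵘ m ℚᵘ.* intᵘ n                        ≈⟨ ℚᵘ.*-cong (ℚ.toℚᵘ-fromℚᵘ (intᵘ m)) (ℚ.toℚᵘ-fromℚᵘ (intᵘ n)) ⟨
  ℚ.toℚᵘ (ℕ→ℚ m) ℚᵘ.* ℚ.toℚᵘ (ℕ→ℚ n)        ≈⟨ ℚ.toℚᵘ-homo-* (ℕ→ℚ m) (ℕ→ℚ n) ⟨
  ℚ.toℚᵘ (ℕ→ℚ m * ℕ→ℚ n)                    ∎)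
  where open import Relation.Binary.Reasoning.Setoid ℚᵘ.≃-setoid

*-self-mono-≤ : ∀ {p q} → 0ℚ ≤ p → p ≤ q → p * p ≤ q * q
*-self-mono-≤ {p} {q} 0≤p p≤q = ℚ.≤-trans
  (ℚ.*-monoˡ-≤-nonNeg p {{ℚ.nonNegative 0≤p}} p≤q)
  (ℚ.*-monoʳ-≤-nonNeg q {{ℚ.nonNegative (ℚ.≤-trans 0≤p p≤q)}} p≤q)

*-self-mono-< : ∀ {p q} → 0ℚ < p → p < q → p * p < q * q
*-self-mono-< {p} {q} 0<p p<q = ℚ.<-trans
  (ℚ.*-monoʳ-<-pos p {{ℚ.positive 0<p}} p<q)
  (ℚ.*-monoˡ-<-pos q {{ℚ.positive (ℚ.<-trans 0<p p<q)}} p<q)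

-- Since `r ≤ 2√k`, the left side k - 2√k is at most `k - r`, hence at most `b`.
k[1-2/√k]≤ : ∀ k .{{_ : NonZero k}} b r → k ℕ.≤ b ℕ.+ r → r ℕ.* r ℕ.≤ 4 ℕ.* k →
             (k ·ℝ (1 -ℝ (2 /ℝ (√ k)))) ≤ℝ ℕ→ℝ b
-- That `q` lies below the left side means, with `w = 1 - q / κ`, that `2 < w * s` for some
-- `0 < s < ρ` with `ρ² ≤ κ`.
k[1-2/√k]≤ k b r k≤b+r r²≤4k q (s , 0<s , (ρ , s<ρ , ρ²≤κ) , 2<ws) =
  -- If `b ≤ q`, then `w * κ = κ - q ≤ r` has square at most 4κ; yet `4 < w²ρ² ≤ w²κ` makes that
  -- square exceed 4κ.
  ℚ.≰⇒> λ b≤q → ℚ.<-irrefl refl (ℚ.<-≤-trans 4κ<[wκ]² ([wκ]²≤4κ b≤q))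
  where
  κ two : ℚ
  κ = ℕ→ℚ k
  two = ℕ→ℚ 2

  instance
    κ-pos : ℚ.Positive κ
    κ-pos = ℚ.positive (ℕ→ℚ-positive k)

    κ-nonZero : ℚ.NonZero κ
    κ-nonZero = ℚ.pos⇒nonZero κ

  w : ℚ
  w = ℕ→ℚ 1 - q * 1/ κ

  wκ≡κ-q : w * κ ≡ κ - q
  wκ≡κ-q = begin
    (1ℚ - q * 1/ κ) * κ      ≡⟨ solve 3 (λ q i κ → (con 1ℚ :- q :* i) :* κ := κ :- q :* (i :* κ)) refl q (1/ κ) κ ⟩
    κ - q * (1/ κ * κ)       ≡⟨ cong (λ z → κ - q * z) (ℚ.*-inverseˡ κ) ⟩
    κ - q * 1ℚ               ≡⟨ cong (λ z → κ - z) (ℚ.*-identityʳ q) ⟩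
    κ - q                    ∎
    where
    open ≡-Reasoning
    open ℚ.+-*-Solver

  0<w : 0ℚ < w
  0<w = ℚ.*-cancelʳ-<-nonNeg s {{ℚ.nonNegative (ℚ.<⇒≤ 0<s)}} {0ℚ} {w}
    (subst (_< w * s) (sym (ℚ.*-zeroˡ s)) (ℚ.<-trans (ℕ→ℚ-positive 2) 2<ws))

  instance
    w-pos : ℚ.Positive w
    w-pos = ℚ.positive 0<w

  0≤wκ : 0ℚ ≤ w * κ
  0≤wκ = subst (_≤ w * κ) (ℚ.*-zeroˡ κ) (ℚ.<⇒≤ (ℚ.*-monoˡ-<-pos κ 0<w))

  4<w²κ : two * two < w * w * κ
  4<w²κ = ℚ.<-≤-trans (*-self-mono-< (ℕ→ℚ-positive 2) (ℚ.<-trans 2<ws (ℚ.*-monoʳ-<-pos w s<ρ)))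
    (subst (_≤ w * w * κ) (solve 2 (λ w ρ → w :* w :* (ρ :* ρ) := w :* ρ :* (w :* ρ)) refl w ρ)
      (ℚ.*-monoˡ-≤-nonNeg (w * w) {{ℚ.nonNegative 0≤w²}} ρ²≤κ))
    where
    open ℚ.+-*-Solver
    0≤w² : 0ℚ ≤ w * w
    0≤w² = subst (_≤ w * w) (ℚ.*-zeroˡ w) (ℚ.<⇒≤ (ℚ.*-monoˡ-<-pos w 0<w))

  4κ<[wκ]² : two * two * κ < w * κ * (w * κ)
  4κ<[wκ]² = subst (two * two * κ <_) (solve 2 (λ w κ → w :* w :* κ :* κ := w :* κ :* (w :* κ)) refl w κ)
    (ℚ.*-monoˡ-<-pos κ 4<w²κ)
    where open ℚ.+-*-Solver

  [wκ]²≤4κ : ℕ→ℚ b ≤ q → w * κ * (w * κ) ≤ two * two * κ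
  [wκ]²≤4κ b≤q = begin
    w * κ * (w * κ)      ≤⟨ *-self-mono-≤ 0≤wκ wκ≤r ⟩
    ℕ→ℚ r * ℕ→ℚ r        ≡⟨ ℕ→ℚ-* r r ⟨
    ℕ→ℚ (r ℕ.* r)        ≤⟨ ℕ→ℚ-mono-≤ r²≤4k ⟩
    ℕ→ℚ (4 ℕ.* k)        ≡⟨ ℕ→ℚ-* 4 k ⟩
    two * two * κ        ∎
    where
    open ℚ.≤-Reasoning
    wκ≤r : w * κ ≤ ℕ→ℚ r
    wκ≤r = begin
      w * κ                          ≡⟨ wκ≡κ-q ⟩
      κ - q                          ≤⟨ ℚ.+-monoʳ-≤ κ (ℚ.neg-antimono-≤ b≤q) ⟩
      κ - ℕ→ℚ b                      ≤⟨ ℚ.+-monoˡ-≤ (ℚ.- ℕ→ℚ b) (ℕ→ℚ-mono-≤ k≤b+r) ⟩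
      ℕ→ℚ (b ℕ.+ r) - ℕ→ℚ b          ≡⟨ cong (_- ℕ→ℚ b) (ℕ→ℚ-+ b r) ⟩
      ℕ→ℚ b + ℕ→ℚ r - ℕ→ℚ b          ≡⟨ solve 2 (λ b r → b :+ r :- b := r) refl (ℕ→ℚ b) (ℕ→ℚ r) ⟩
      ℕ→ℚ r                          ∎
      where open ℚ.+-*-Solver

-- Choice of the parameters `t` and `n`.

theorem3 : (k : ℕ) .{{_ : NonZero k}} →
    ∃ λ (G : Graph) → (tw[ G ]≤ k) × (box[ G ]≥ (k ·ℝ (1 -ℝ (2 /ℝ (√ k)))))
theorem3 k with r , r²≤4k , 4k<[1+r]² ← isqrt (4 ℕ.* k) = choose (r ℕ.≤? k)
  where
  -- The three inequalities govern, in turn, the treewidth, the colouring and the passage from `t`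
  -- to the real bound.
  witness : ∀ t n → t ℕ.+ n ℕ.≤ suc k → 4 ℕ.* t ℕ.≤ 3 ℕ.+ suc n ℕ.* n → k ℕ.≤ t ℕ.+ r →
            ∃ λ (G : Graph) → (tw[ G ]≤ k) × (box[ G ]≥ (k ·ℝ (1 -ℝ (2 /ℝ (√ k)))))
  witness t n t+n≤1+k 4t≤ k≤t+r =
    graph , tw≤ t+n≤1+k , (_ , boxRepresentation graph) ,
    λ b rep → k[1-2/√k]≤ k b r (ℕ.≤-trans k≤t+r (ℕ.+-monoˡ-≤ r (boxicity≥ t n b rep 4t≤))) r²≤4k
    where open ColouringGraph t n

  choose : Dec (r ℕ.≤ k) →
           ∃ λ (G : Graph) → (tw[ G ]≤ k) × (box[ G ]≥ (k ·ℝ (1 -ℝ (2 /ℝ (√ k)))))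
  -- For `r > k` the number `k - r` is negative and the empty graph suffices.
  choose (no r≰k)  = witness 0 0 z≤n z≤n (ℕ.≰⇒≥ r≰k)
  -- `n = r + 1` makes `t + n` exactly `k + 1`, and `4k < (r + 1)²` leaves enough colours.
  choose (yes r≤k) = witness (k ℕ.∸ r) (suc r) width≤ (begin
    4 ℕ.* (k ℕ.∸ r)                  ≤⟨ ℕ.*-monoʳ-≤ 4 (ℕ.m∸n≤m k r) ⟩
    4 ℕ.* k                          ≤⟨ ℕ.<⇒≤ 4k<[1+r]² ⟩
    suc r ℕ.* suc r                  ≤⟨ ℕ.*-monoˡ-≤ (suc r) (ℕ.n≤1+n (suc r)) ⟩
    suc (suc r) ℕ.* suc r            ≤⟨ ℕ.m≤n+m _ 3 ⟩
    3 ℕ.+ suc (suc r) ℕ.* suc r      ∎) (ℕ.≤-reflexive (sym (ℕ.m∸n+n≡m r≤k)))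
    where
    open ℕ.≤-Reasoning
    width≤ : k ℕ.∸ r ℕ.+ suc r ℕ.≤ suc k
    width≤ = ℕ.≤-reflexive (trans (ℕ.+-suc (k ℕ.∸ r) r) (cong suc (ℕ.m∸n+n≡m r≤k)))
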